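{- Let $r=\langle L\leftarrow K\rightarrow R\rangle$ be a rule of an R-GT system over $\mathcal L$. Then for all TLRGs $G,H$ over $\mathcal L$: $G\Rightarrow_r H$ (in the R-GT sense) if and only if $e(G)\Rightarrow_{e(r)}e(H)$ (in the T-GT sense), where $e(r)=\langle e(L)\leftarrow e(K)\rightarrow e(R)\rangle$ with the encoded inclusions.
   Context: Let $\mathcal L=(\mathcal L_V,\mathcal L_E)$ be a label alphabet with $\mathcal L_V\cap\mathcal L_E=\emptyset$ and $\{\square,0,1\}\cap(\mathcal L_V\cup\mathcal L_E)=\emptyset$. R-GT setting: graphs $G=(V,E,s,t,l,m,p)$ with $V,E$ finite, $s,t:E\to V$ total, $l:V\rightharpoonup\mathcal L_V$ partial, $m:E\to\mathcal L_E$ total, $p:V\rightharpoonup\{0,1\}$ partial (rootedness); TLRG = $l,p$ total; morphisms preserve sources, targets, edge labels, and node labels and rootedness wherever defined. A rule has TLRGs $L,R$ and a common subgraph $K$ (sets included, $s,t,m$ restricted, $l_K\subseteq l_L$, $p_K\subseteq p_L$, likewise for $R$). Applied to TLRG $G$ via an injective $g:L\to G$ satisfying the dangling condition (no edge outside $g(L)$ incident to a node of $g(V_L\setminus V_K)$): delete images of items of $L$ not in $K$ and undefine label/rootedness of $g_V(v)$ where undefined for $v\in V_K$; add disjointly items of $R$ not in $K$ and set label/rootedness of $g_V(v)$ to $l_R(v)/p_R(v)$ where undefined in $K$; $G\Rightarrow_r H$ if $H$ is isomorphic to the result. T-GT setting: totally labelled graphs $(V,E,s,t,l,m)$, morphisms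 preserving sources, targets, labels; rules $\langle L\leftarrow K\rightarrow R\rangle$ of totally labelled graphs with $K$ a subgraph of $L,R$; a direct derivation via an injective match satisfying the dangling condition deletes $g(L\setminus K)$ and adds $R\setminus K$ disjointly (result up to isomorphism). Encoding: $e(\mathcal L)=(\{\square\},\mathcal L_E\cup\mathcal L_V\cup\{0,1\})$; for a graph $G$, $e(G)$ has nodes $V$ all labelled $\square$, an edge $(e,0)$ from $s(e)$ to $t(e)$ labelled $m(e)$ for each $e\in E$, a loop $(v,1)$ at $v$ labelled $l(v)$ for each $v$ with $l(v)$ defined, and a loop $(v,2)$ at $v$ labelled $p(v)$ for each $v$ with $p(v)$ defined; morphisms are encoded by $g_V$ on nodes, $(e,0)\mapsto(g_E(e),0)$, $(v,i)\mapsto(g_V(v),i)$. -}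

module Defs where

open import Data.Empty using (⊥-elim)
open import Data.Fin.Base using (Fin; zero; suc)
open import Data.Fin.Properties as Fin using (any?; +↔⊎)
open import Data.Irrelevant using ([_])
open import Data.Maybe.Base using (Maybe; just; nothing; maybe)
open import Data.Maybe using (Is-just; to-witness)
import Data.Maybe.Relation.Unary.Any as Any
open import Data.Nat.Base using (zero; suc)
open import Data.Product.Base using (Σ; ∃-syntax; Σ-syntax; _×_; _,_; proj₁; proj₂)
open import Data.Refinement.Base using (Refinement-syntax; value; _,_)
open import Data.Sum.Base using (_⊎_; inj₁; inj₂)
open import Data.Sum.Function.Propositional using (_⊎-↔_)
open import Data.Unit.Base using (⊤; tt)
open import Function.Base using (_∘_; const)
open import Function.Bundles using (_↔_; Inverse; mk↔ₛ′)
open import Function.Definitions using (Injective)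
open import Function.Properties.Inverse using (↔-sym; ↔-trans; ↔⇒↣)
open import Relation.Binary.Definitions using (DecidableEquality)
open import Relation.Binary.PropositionalEquality
  using (_≡_; refl; sym; trans; cong; subst)
open import Relation.Nullary using (Dec; yes; no; ¬_; ¬?; recompute)
open import Relation.Nullary.Decidable using (map′; via-injection; _×-dec_)
open import Relation.Unary using (Decidable)

Finite : Set → Set
Finite A = ∃[ n ] (A ↔ Fin n)

finite-⊎ : {A B : Set} → Finite A → Finite B → Finite (A ⊎ B)
finite-⊎ (_ , f) (_ , g) = _ , ↔-trans (f ⊎-↔ g) (↔-sym +↔⊎)

finite-≟ : {A : Set} → Finite A → DecidableEquality A
finite-≟ (_ , f) = via-injection (↔⇒↣ f) Fin._≟_

finite-any? : {A : Set} {P : A → Set} → Finite A → Decidable P → Dec (∃[ a ] P a)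
finite-any? {P = P} (_ , f) P? =
  map′ (λ (i , p) → from i , p)
       (λ (a , p) → to a , subst P (sym (strictlyInverseʳ a)) p)
       (any? (P? ∘ from))
  where open Inverse f

refine-≡ : {A : Set} {P : A → Set} {a b : A} .{p : P a} .{q : P b} → a ≡ b →
           _≡_ {A = [ x ∈ A ∣ P x ]} (a , [ p ]) (b , [ q ])
refine-≡ refl = refl

refine-Fin : ∀ n {P : Fin n → Set} → Decidable P → Finite [ i ∈ Fin n ∣ P i ]
refine-Fin zero P? = 0 , mk↔ₛ′ (λ ()) (λ ()) (λ ()) (λ ())
refine-Fin (suc n) {P} P? with P? zero | refine-Fin n (P? ∘ suc)
... | yes p | k , f = suc k , mk↔ₛ′ to′ from′ to-from from-to
  where
  open Inverse f
  to′ : [ i ∈ Fin (suc n) ∣ P i ] → Fin (suc k)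
  to′ (zero  , _) = zero
  to′ (suc i , q) = suc (to (i , q))
  from′ : Fin (suc k) → [ i ∈ Fin (suc n) ∣ P i ]
  from′ zero    = zero , [ p ]
  from′ (suc j) with from j
  ... | i , q = suc i , q
  to-from : ∀ j → to′ (from′ j) ≡ j
  to-from zero    = refl
  to-from (suc j) = cong suc (strictlyInverseˡ j)
  from-to : ∀ x → from′ (to′ x) ≡ x
  from-to (zero  , _) = refl
  from-to (suc i , q) rewrite strictlyInverseʳ (i , q) = refl
... | no ¬p | k , f = k , mk↔ₛ′ to′ from′ to-from from-to
  where
  open Inverse f
  to′ : [ i ∈ Fin (suc n) ∣ P i ] → Fin k
  to′ (zero  , [ p ]) = ⊥-elim (¬p (recompute (no ¬p) p))
  to′ (suc i , q) = to (i , q)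
  from′ : Fin k → [ i ∈ Fin (suc n) ∣ P i ]
  from′ j with from j
  ... | i , q = suc i , q
  to-from : ∀ j → to′ (from′ j) ≡ j
  to-from j = strictlyInverseˡ j
  from-to : ∀ x → from′ (to′ x) ≡ x
  from-to (zero  , [ p ]) = ⊥-elim (¬p (recompute (no ¬p) p))
  from-to (suc i , q) rewrite strictlyInverseʳ (i , q) = refl

finite-refine : {A : Set} {P : A → Set} →
                Finite A → Decidable P → Finite [ a ∈ A ∣ P a ]
finite-refine {A} {P} (n , f) P? =
  let k , h = refine-Fin n (P? ∘ from) in k , ↔-trans (mk↔ₛ′ to′ from′ to-from from-to) h
  where
  open Inverse f
  to′ : [ a ∈ A ∣ P a ] → [ i ∈ Fin n ∣ P (from i) ]
  to′ (a , [ p ]) = to a , [ subst P (sym (strictlyInverseʳ a)) p ]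
  from′ : [ i ∈ Fin n ∣ P (from i) ] → [ a ∈ A ∣ P a ]
  from′ (i , p) = from i , p
  to-from : ∀ y → to′ (from′ y) ≡ y
  to-from (i , _) = refine-≡ (strictlyInverseˡ i)
  from-to : ∀ x → from′ (to′ x) ≡ x
  from-to (a , _) = refine-≡ (strictlyInverseʳ a)

finite-Is-just : {A B : Set} (f : A → Maybe B) → Finite A → Finite (Σ[ a ∈ A ] Is-just (f a))
finite-Is-just {A} f fin =
  let k , h = finite-refine fin just? in k , ↔-trans (mk↔ₛ′ to′ from′ (λ _ → refl) from-to) h
  where
  just? : Decidable (λ a → Is-just (f a))
  just? a = Any.dec (λ _ → yes tt) (f a)
  to′ : Σ[ a ∈ A ] Is-just (f a) → [ a ∈ A ∣ Is-just (f a) ]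
  to′ (a , p) = a , [ p ]
  from′ : [ a ∈ A ∣ Is-just (f a) ] → Σ[ a ∈ A ] Is-just (f a)
  from′ (a , [ p ]) = a , recompute (just? a) p
  from-to : ∀ x → from′ (to′ x) ≡ x
  from-to (a , p) = cong (a ,_) (Any.irrelevant (λ _ _ → refl) _ _)

_∈im_ : {A B : Set} → B → (A → B) → Set
b ∈im f = ∃[ a ] (f a ≡ b)

∈im? : {A B : Set} → Finite A → Finite B → (f : A → B) (b : B) → Dec (b ∈im f)
∈im? finA finB f b = finite-any? finA (λ a → finite-≟ finB (f a) b)

-- The data (V, E, s, t, m) common to partially labelled rooted graphs and
-- totally labelled graphs.

record Skeleton (Lab : Set) : Set₁ where
  field
    V E      : Set
    V-finite : Finite V
    E-finite : Finite E
    s t      : E → V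
    m        : E → Lab

open Skeleton public

variable Lab : Set

record SkeletonMor (A B : Skeleton Lab) : Set where
  field
    fV     : V A → V B
    fE     : E A → E B
    s-pres : ∀ e → s B (fE e) ≡ fV (s A e)
    t-pres : ∀ e → t B (fE e) ≡ fV (t A e)
    m-pres : ∀ e → m B (fE e) ≡ m A e

open SkeletonMor public

IsInjective : {A B : Skeleton Lab} → SkeletonMor A B → Set
IsInjective f = Injective _≡_ _≡_ (fV f) × Injective _≡_ _≡_ (fE f)

MutuallyInverse : {A B : Skeleton Lab} → SkeletonMor A B → SkeletonMor B A → Set
MutuallyInverse f g =
    ((∀ v → fV g (fV f v) ≡ v) × (∀ e → fE g (fE f e) ≡ e))
  × ((∀ v → fV f (fV g v) ≡ v) × (∀ e → fE f (fE g e) ≡ e))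

-- Below, a subgraph K of L is given by an injective morphism i : K → L, so
-- that x ∈ K, for an item x of L, reads  x ∈im i.

module _ {K L G : Skeleton Lab} (i : SkeletonMor K L) (g : SkeletonMor L G) where

  DeletedV : V G → Set
  DeletedV v = ∃[ u ] (¬ (u ∈im fV i) × fV g u ≡ v)

  DeletedE : E G → Set
  DeletedE e = ∃[ x ] (¬ (x ∈im fE i) × fE g x ≡ e)

  Dangling : Set
  Dangling = ∀ e → ¬ (e ∈im fE g) → ¬ DeletedV (s G e) × ¬ DeletedV (t G e)

-- D = G − g(L ∖ K), together with the induced morphism K → D.

module Deletion {K L G : Skeleton Lab} (i : SkeletonMor K L) (g : SkeletonMor L G)
                (g-inj : IsInjective g) (dangling : Dangling i g) where

  deletedV? : Decidable (DeletedV i g)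
  deletedV? v = finite-any? (V-finite L) λ u →
    ¬? (∈im? (V-finite K) (V-finite L) (fV i) u) ×-dec finite-≟ (V-finite G) (fV g u) v

  deletedE? : Decidable (DeletedE i g)
  deletedE? e = finite-any? (E-finite L) λ x →
    ¬? (∈im? (E-finite K) (E-finite L) (fE i) x) ×-dec finite-≟ (E-finite G) (fE g x) e

  preserved-V : ∀ k → ¬ DeletedV i g (fV g (fV i k))
  preserved-V k (u , u∉K , eq) = u∉K (k , sym (proj₁ g-inj eq))

  preserved-E : ∀ k → ¬ DeletedE i g (fE g (fE i k))
  preserved-E k (x , x∉K , eq) = x∉K (k , sym (proj₂ g-inj eq))

  -- Used with the source maps and with the target maps of K, L and G: no
  -- preserved edge is incident to a deleted node.
  endpoint : (sK : E K → V K) (sL : E L → V L) (sG : E G → V G) →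
             (∀ e → sL (fE i e) ≡ fV i (sK e)) → (∀ e → sG (fE g e) ≡ fV g (sL e)) →
             (∀ e → ¬ (e ∈im fE g) → ¬ DeletedV i g (sG e)) →
             ∀ e → ¬ DeletedE i g e → ¬ DeletedV i g (sG e)
  endpoint sK sL sG i-pres g-pres dang e e-kept del = dang e e∉g del
    where
    e∉g : ¬ (e ∈im fE g)
    e∉g (x , refl) = e-kept (x , x∉K , refl)
      where
      x∉K : ¬ (x ∈im fE i)
      x∉K (k , refl) =
        preserved-V (sK k)
          (subst (DeletedV i g) (trans (g-pres (fE i k)) (cong (fV g) (i-pres k))) del)

  D : Skeleton Lab
  D .V = [ v ∈ V G ∣ ¬ DeletedV i g v ]
  D .E = [ e ∈ E G ∣ ¬ DeletedE i g e ]
  D .V-finite = finite-refine (V-finite G) (¬? ∘ deletedV?)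
  D .E-finite = finite-refine (E-finite G) (¬? ∘ deletedE?)
  D .s (e , [ p ]) = s G e , [ endpoint (s K) (s L) (s G) (s-pres i) (s-pres g) (λ e′ q → proj₁ (dangling e′ q)) e p ]
  D .t (e , [ p ]) = t G e , [ endpoint (t K) (t L) (t G) (t-pres i) (t-pres g) (λ e′ q → proj₂ (dangling e′ q)) e p ]
  D .m (e , _) = m G e

  d : SkeletonMor K D
  d .fV k = fV g (fV i k) , [ preserved-V k ]
  d .fE k = fE g (fE i k) , [ preserved-E k ]
  d .s-pres k = refine-≡ (trans (s-pres g (fE i k)) (cong (fV g) (s-pres i k)))
  d .t-pres k = refine-≡ (trans (t-pres g (fE i k)) (cong (fV g) (t-pres i k)))
  d .m-pres k = trans (m-pres g (fE i k)) (m-pres i k)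

-- D + (R ∖ K), glued along d : K → D: an added edge whose endpoint in R is
-- the image of a node k of K is attached to d(k).

module Addition {K D R : Skeleton Lab} (d : SkeletonMor K D) (j : SkeletonMor K R) where

  AddedV AddedE : Set
  AddedV = [ u ∈ V R ∣ ¬ (u ∈im fV j) ]
  AddedE = [ x ∈ E R ∣ ¬ (x ∈im fE j) ]

  glue : V R → V D ⊎ AddedV
  glue u with ∈im? (V-finite K) (V-finite R) (fV j) u
  ... | yes (k , _) = inj₁ (fV d k)
  ... | no u∉K      = inj₂ (u , [ u∉K ])

  H : Skeleton Lab
  H .V = V D ⊎ AddedV
  H .E = E D ⊎ AddedE
  H .V-finite = finite-⊎ (V-finite D)
    (finite-refine (V-finite R) (¬? ∘ ∈im? (V-finite K) (V-finite R) (fV j)))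
  H .E-finite = finite-⊎ (E-finite D)
    (finite-refine (E-finite R) (¬? ∘ ∈im? (E-finite K) (E-finite R) (fE j)))
  H .s (inj₁ e)       = inj₁ (s D e)
  H .s (inj₂ (x , _)) = glue (s R x)
  H .t (inj₁ e)       = inj₁ (t D e)
  H .t (inj₂ (x , _)) = glue (t R x)
  H .m (inj₁ e)       = m D e
  H .m (inj₂ (x , _)) = m R x

-- The two label sets are separate types, hence disjoint.

record Alphabet : Set₁ where
  field
    LV LE : Set

open Alphabet public

variable 𝓛 : Alphabet

-- Partial functions A ⇀ B are maps A → Maybe B.

module R-GT where

  record Graph (𝓛 : Alphabet) : Set₁ where
    field
      skeleton : Skeleton (LE 𝓛)
      l        : V skeleton → Maybe (LV 𝓛)
      p        : V skeleton → Maybe (Fin 2)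

  open Graph public

  record IsTLRG (G : Graph 𝓛) : Set where
    field
      l-total : ∀ v → Is-just (l G v)
      p-total : ∀ v → Is-just (p G v)

  record Mor (G H : Graph 𝓛) : Set where
    field
      skel   : SkeletonMor (skeleton G) (skeleton H)
      l-pres : ∀ v x → l G v ≡ just x → l H (fV skel v) ≡ just x
      p-pres : ∀ v x → p G v ≡ just x → p H (fV skel v) ≡ just x

  open Mor public

  _≅_ : Graph 𝓛 → Graph 𝓛 → Set
  G ≅ H = ∃[ f ] ∃[ g ] MutuallyInverse (skel {G = G} {H} f) (skel {G = H} {G} g)

  record Rule (𝓛 : Alphabet) : Set₁ where
    field
      L K R  : Graph 𝓛
      L-tlrg : IsTLRG L
      R-tlrg : IsTLRG R
      i      : Mor K L
      j      : Mor K R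
      i-inj  : IsInjective (skel i)
      j-inj  : IsInjective (skel j)

  -- override d lK new old  agrees with old, except that at d(k) it is new(k)
  -- for every k where lK is undefined.  (d is injective when it is used.)
  override : {K D : Skeleton Lab} {A : Set} (d : SkeletonMor K D) →
             (lK new : V K → Maybe A) (old : V D → Maybe A) → V D → Maybe A
  override {K = K} {D} d lK new old v with ∈im? (V-finite K) (V-finite D) (fV d) v
  ... | yes (k , _) = maybe (const (old v)) (new k) (lK k)
  ... | no _        = old v

  module Derivation (r : Rule 𝓛) {G : Graph 𝓛} (g : Mor (Rule.L r) G)
                    (g-inj : IsInjective (skel g))
                    (dangling : Dangling (skel (Rule.i r)) (skel g)) where
    open Rule r
    module Del = Deletion (skel i) (skel g) g-inj dangling
    module Add = Addition Del.d (skel j)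

    -- The intermediate graph, with labels and rootedness undefined at the
    -- nodes of K where K leaves them undefined.
    context : Graph 𝓛
    context .skeleton = Del.D
    context .l = override Del.d (l K) (const nothing) (l G ∘ value)
    context .p = override Del.d (p K) (const nothing) (p G ∘ value)

    result : Graph 𝓛
    result .skeleton = Add.H
    result .l (inj₁ v)       = override Del.d (l K) (l R ∘ fV (skel j)) (l context) v
    result .l (inj₂ (u , _)) = l R u
    result .p (inj₁ v)       = override Del.d (p K) (p R ∘ fV (skel j)) (p context) v
    result .p (inj₂ (u , _)) = p R u

  _⇒⟨_⟩_ : Graph 𝓛 → Rule 𝓛 → Graph 𝓛 → Set
  G ⇒⟨ r ⟩ H =
    Σ[ g ∈ Mor (Rule.L r) G ]
    Σ[ g-inj ∈ IsInjective (skel g) ]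
    Σ[ dangling ∈ Dangling (skel (Rule.i r)) (skel g) ]
    (H ≅ Derivation.result r g g-inj dangling)

module T-GT where

  record Graph (𝓛 : Alphabet) : Set₁ where
    field
      skeleton : Skeleton (LE 𝓛)
      l        : V skeleton → LV 𝓛

  open Graph public

  record Mor (G H : Graph 𝓛) : Set where
    field
      skel   : SkeletonMor (skeleton G) (skeleton H)
      l-pres : ∀ v → l H (fV skel v) ≡ l G v

  open Mor public

  _≅_ : Graph 𝓛 → Graph 𝓛 → Set
  G ≅ H = ∃[ f ] ∃[ g ] MutuallyInverse (skel {G = G} {H} f) (skel {G = H} {G} g)

  record Rule (𝓛 : Alphabet) : Set₁ where
    field
      L K R : Graph 𝓛
      i     : Mor K L
      j     : Mor K R
      i-inj : IsInjective (skel i)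
      j-inj : IsInjective (skel j)

  module Derivation (r : Rule 𝓛) {G : Graph 𝓛} (g : Mor (Rule.L r) G)
                    (g-inj : IsInjective (skel g))
                    (dangling : Dangling (skel (Rule.i r)) (skel g)) where
    open Rule r
    module Del = Deletion (skel i) (skel g) g-inj dangling
    module Add = Addition Del.d (skel j)

    result : Graph 𝓛
    result .skeleton = Add.H
    result .l (inj₁ v)       = l G (value v)
    result .l (inj₂ (u , _)) = l R u

  _⇒⟨_⟩_ : Graph 𝓛 → Rule 𝓛 → Graph 𝓛 → Set
  G ⇒⟨ r ⟩ H =
    Σ[ g ∈ Mor (Rule.L r) G ]
    Σ[ g-inj ∈ IsInjective (skel g) ]
    Σ[ dangling ∈ Dangling (skel (Rule.i r)) (skel g) ]
    (H ≅ Derivation.result r g g-inj dangling)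

-- The single node label □ is tt; the edge labels are the disjoint union of
-- the edge labels, the node labels and {0,1} = Fin 2.
e-alphabet : Alphabet → Alphabet
e-alphabet 𝓛 .LV = ⊤
e-alphabet 𝓛 .LE = LE 𝓛 ⊎ LV 𝓛 ⊎ Fin 2

module _ (G : R-GT.Graph 𝓛) where
  open R-GT using (skeleton; l; p)

  e-Edge : Set
  e-Edge = E (skeleton G)
         ⊎ (Σ[ v ∈ V (skeleton G) ] Is-just (l G v))
         ⊎ (Σ[ v ∈ V (skeleton G) ] Is-just (p G v))

-- The edges (e,0), (v,1) and (v,2); the last two carry the evidence that
-- l(v), respectively p(v), is defined.
pattern edge e        = inj₁ e
pattern labelLoop v q = inj₂ (inj₁ (v , q))
pattern rootLoop  v q = inj₂ (inj₂ (v , q))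

e-graph : R-GT.Graph 𝓛 → T-GT.Graph (e-alphabet 𝓛)
e-graph {𝓛} G = record { skeleton = skel ; l = const tt }
  where
  open R-GT using (skeleton; l; p)
  G₀ : Skeleton (LE 𝓛)
  G₀ = skeleton G
  endpoint : (E G₀ → V G₀) → e-Edge G → V G₀
  endpoint st (edge e)        = st e
  endpoint st (labelLoop v _) = v
  endpoint st (rootLoop  v _) = v
  label : e-Edge G → LE (e-alphabet 𝓛)
  label (edge e)        = inj₁ (m G₀ e)
  label (labelLoop _ q) = inj₂ (inj₁ (to-witness q))
  label (rootLoop  _ q) = inj₂ (inj₂ (to-witness q))
  skel : Skeleton (LE (e-alphabet 𝓛))
  skel .V = V G₀
  skel .E = e-Edge G
  skel .V-finite = V-finite G₀
  skel .E-finite = finite-⊎ (E-finite G₀)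
    (finite-⊎ (finite-Is-just (l G) (V-finite G₀)) (finite-Is-just (p G) (V-finite G₀)))
  skel .s = endpoint (s G₀)
  skel .t = endpoint (t G₀)
  skel .m = label

defined : {A : Set} {b : Maybe A} {x : A} → b ≡ just x → Is-just b
defined refl = Any.just tt

defined-witness : {A : Set} {b : Maybe A} {x : A} (eq : b ≡ just x) → to-witness (defined eq) ≡ x
defined-witness refl = refl

transfer : {A : Set} {a b : Maybe A} → (∀ x → a ≡ just x → b ≡ just x) → Is-just a → Is-just b
transfer {a = just x} f _ = defined (f x refl)

transfer-witness : {A : Set} {a b : Maybe A} (f : ∀ x → a ≡ just x → b ≡ just x) (q : Is-just a) →
                   to-witness (transfer f q) ≡ to-witness q
transfer-witness {a = just x} f (Any.just _) = defined-witness (f x refl)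

e-mor : {G H : R-GT.Graph 𝓛} → R-GT.Mor G H → T-GT.Mor (e-graph G) (e-graph H)
e-mor {𝓛} {G} {H} f = record { skel = ef ; l-pres = λ _ → refl }
  where
  open R-GT using (skel; l-pres; p-pres)
  ef : SkeletonMor (T-GT.skeleton (e-graph G)) (T-GT.skeleton (e-graph H))
  ef .fV = fV (skel f)
  ef .fE (edge e)        = edge (fE (skel f) e)
  ef .fE (labelLoop v q) = labelLoop (fV (skel f) v) (transfer (l-pres f v) q)
  ef .fE (rootLoop  v q) = rootLoop  (fV (skel f) v) (transfer (p-pres f v) q)
  ef .s-pres (edge e)        = s-pres (skel f) e
  ef .s-pres (labelLoop _ _) = refl
  ef .s-pres (rootLoop  _ _) = refl
  ef .t-pres (edge e)        = t-pres (skel f) e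
  ef .t-pres (labelLoop _ _) = refl
  ef .t-pres (rootLoop  _ _) = refl
  ef .m-pres (edge e)        = cong inj₁ (m-pres (skel f) e)
  ef .m-pres (labelLoop v q) = cong (inj₂ ∘ inj₁) (transfer-witness (l-pres f v) q)
  ef .m-pres (rootLoop  v q) = cong (inj₂ ∘ inj₂) (transfer-witness (p-pres f v) q)

e-mor-injective : {G H : R-GT.Graph 𝓛} (f : R-GT.Mor G H) →
                  IsInjective (R-GT.skel f) → IsInjective (T-GT.skel (e-mor f))
e-mor-injective {G = G} f (injV , injE) = injV , injE′ _ _
  where
  inj₂-inj : {A B : Set} {x y : B} → inj₂ {A = A} x ≡ inj₂ y → x ≡ y
  inj₂-inj refl = refl
  inj₁-inj : {A B : Set} {x y : A} → inj₁ {B = B} x ≡ inj₁ y → x ≡ y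
  inj₁-inj refl = refl
  Σ-≡ : {A B : Set} {h : A → Maybe B} {v w : A} {q : Is-just (h v)} {q′ : Is-just (h w)} →
        v ≡ w → _≡_ {A = Σ[ a ∈ A ] Is-just (h a)} (v , q) (w , q′)
  Σ-≡ {v = v} refl = cong (v ,_) (Any.irrelevant (λ _ _ → refl) _ _)
  injE′ : ∀ x y → fE (T-GT.skel (e-mor f)) x ≡ fE (T-GT.skel (e-mor f)) y → x ≡ y
  injE′ (edge _)        (edge _)        eq = cong inj₁ (injE (inj₁-inj eq))
  injE′ (labelLoop _ _) (labelLoop _ _) eq =
    cong (inj₂ ∘ inj₁) (Σ-≡ (injV (cong proj₁ (inj₁-inj (inj₂-inj eq)))))
  injE′ (rootLoop _ _)  (rootLoop _ _)  eq =
    cong (inj₂ ∘ inj₂) (Σ-≡ (injV (cong proj₁ (inj₂-inj (inj₂-inj eq)))))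
  injE′ (edge _)        (labelLoop _ _) ()
  injE′ (edge _)        (rootLoop _ _)  ()
  injE′ (labelLoop _ _) (edge _)        ()
  injE′ (labelLoop _ _) (rootLoop _ _)  ()
  injE′ (rootLoop _ _)  (edge _)        ()
  injE′ (rootLoop _ _)  (labelLoop _ _) ()

e-rule : R-GT.Rule 𝓛 → T-GT.Rule (e-alphabet 𝓛)
e-rule r = record
  { L     = e-graph L
  ; K     = e-graph K
  ; R     = e-graph R
  ; i     = e-mor i
  ; j     = e-mor j
  ; i-inj = e-mor-injective i i-inj
  ; j-inj = e-mor-injective j j-inj
  }
  where open R-GT.Rule r

{-# OPTIONS --safe #-}
module Submission where

-- Edge labels separate the three kinds of edges of an encoding, so morphisms
-- between encodings, and in particular matches and isomorphisms, are exactly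
-- the encoded ones.  It remains to see that encoding commutes with applying a
-- rule.  On nodes and proper edges the two constructions coincide.  At a node k
-- of K a label is either defined in K, and then its loop survives the
-- application, or undefined, and then the old loop is deleted and the loop of R
-- is added: this is the overriding of labels in the rooted setting.  A node
-- outside K takes its loops with it, as all labels of L, R and G are defined.

open import Defs
open import Data.Empty using (⊥; ⊥-elim; ⊥-elim-irr)
open import Data.Fin.Base using (Fin)
open import Data.Irrelevant using ([_])
open import Data.Maybe.Base using (Maybe; just; nothing)
open import Data.Maybe using (Is-just; to-witness)
import Data.Maybe.Relation.Unary.Any as Any
open import Data.Product.Base using (∃-syntax; _×_; _,_; proj₁; proj₂)
open import Data.Refinement.Base using (value; _,_)
open import Data.Sum.Base using (_⊎_; inj₁; inj₂)
open import Data.Sum.Properties using (inj₁-injective; inj₂-injective)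
open import Data.Unit.Base using (tt)
open import Function.Base using (_∘_; const; id)
open import Function.Bundles using (_⇔_; mk⇔)
open import Function.Definitions using (Injective)
open import Relation.Binary.PropositionalEquality
  using (_≡_; refl; sym; trans; cong; subst)
open import Relation.Nullary using (yes; no; ¬_; contradiction)

-- Evidence that a partial function is defined

Is-just-irrelevant : {A : Set} {b : Maybe A} (p q : Is-just b) → p ≡ q
Is-just-irrelevant = Any.irrelevant (λ _ _ → refl)

witness-cong : {A : Set} {b c : Maybe A} → b ≡ c → (p : Is-just b) (q : Is-just c) →
               to-witness p ≡ to-witness q
witness-cong refl p q = cong to-witness (Is-just-irrelevant p q)

witness⇒just : {A : Set} {b : Maybe A} {x : A} (q : Is-just b) → to-witness q ≡ x → b ≡ just x
witness⇒just (Any.just _) refl = refl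

-- Isomorphisms of skeletons

record _≅ₛ_ (A B : Skeleton Lab) : Set where
  constructor mk≅
  field
    forth   : SkeletonMor A B
    back    : SkeletonMor B A
    inverse : MutuallyInverse forth back

≅ₛ-sym : {A B : Skeleton Lab} → A ≅ₛ B → B ≅ₛ A
≅ₛ-sym (mk≅ f g (gf , fg)) = mk≅ g f (fg , gf)

≅ₛ-trans : {A B C : Skeleton Lab} → A ≅ₛ B → B ≅ₛ C → A ≅ₛ C
≅ₛ-trans (mk≅ f f⁻¹ ((fv , fe) , (fv′ , fe′))) (mk≅ g g⁻¹ ((gv , ge) , (gv′ , ge′))) =
  mk≅ (comp f g) (comp g⁻¹ f⁻¹)
  ( ((λ v → trans (cong (fV f⁻¹) (gv _)) (fv v)) , (λ e → trans (cong (fE f⁻¹) (ge _)) (fe e)))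
  , ((λ v → trans (cong (fV g) (fv′ _)) (gv′ v)) , (λ e → trans (cong (fE g) (fe′ _)) (ge′ e))) )
  where
  comp : {A B C : Skeleton Lab} → SkeletonMor A B → SkeletonMor B C → SkeletonMor A C
  comp f g .fV = fV g ∘ fV f
  comp f g .fE = fE g ∘ fE f
  comp f g .s-pres e = trans (s-pres g _) (cong (fV g) (s-pres f e))
  comp f g .t-pres e = trans (t-pres g _) (cong (fV g) (t-pres f e))
  comp f g .m-pres e = trans (m-pres g _) (m-pres f e)

-- The inverse of a bijective morphism preserves structure automatically, by cancelling `f`. Hence
-- only one direction of a comparison has to be checked to be a morphism.
bijective⇒≅ₛ : {A B : Skeleton Lab} (f : SkeletonMor A B) (gV : V B → V A) (gE : E B → E A) →
               (∀ v → gV (fV f v) ≡ v) → (∀ e → gE (fE f e) ≡ e) →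
               (∀ v → fV f (gV v) ≡ v) → (∀ e → fE f (gE e) ≡ e) → A ≅ₛ B
bijective⇒≅ₛ {A = A} {B} f gV gE gfV gfE fgV fgE = mk≅ f g ((gfV , gfE) , (fgV , fgE))
  where
  endpoint-pres : (sA : E A → V A) (sB : E B → V B) → (∀ e → sB (fE f e) ≡ fV f (sA e)) →
                  ∀ e → sA (gE e) ≡ gV (sB e)
  endpoint-pres sA sB pres e =
    trans (sym (gfV _)) (cong gV (trans (sym (pres _)) (cong sB (fgE e))))
  g : SkeletonMor B A
  g .fV = gV
  g .fE = gE
  g .s-pres = endpoint-pres (s A) (s B) (s-pres f)
  g .t-pres = endpoint-pres (t A) (t B) (t-pres f)
  g .m-pres e = trans (sym (m-pres f _)) (cong (m B) (fgE e))

-- Labels and rootedness treated uniformly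

data Attr : Set where
  label root : Attr

Value : Alphabet → Attr → Set
Value 𝓛 label = LV 𝓛
Value 𝓛 root  = Fin 2

module _ {𝓛 : Alphabet} (G : R-GT.Graph 𝓛) where
  open R-GT using (skeleton; l; p)

  encode : Skeleton (LE (e-alphabet 𝓛))
  encode = T-GT.skeleton (e-graph {𝓛} G)

  attr : (a : Attr) → V (skeleton G) → Maybe (Value 𝓛 a)
  attr label = l G
  attr root  = p G

  loop : (a : Attr) (v : V (skeleton G)) → Is-just (attr a v) → e-Edge G
  loop label = labelLoop
  loop root  = rootLoop

  loop-cong : ∀ a {v w} {q : Is-just (attr a v)} {q′ : Is-just (attr a w)} →
              v ≡ w → loop a v q ≡ loop a w q′
  loop-cong a {v} refl = cong (loop a v) (Is-just-irrelevant _ _)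

  loop-injective : ∀ a b {v w} {q : Is-just (attr a v)} {q′ : Is-just (attr b w)} →
                   loop a v q ≡ loop b w q′ → a ≡ b × v ≡ w
  loop-injective label label refl = refl , refl
  loop-injective root  root  refl = refl , refl

  edge≢loop : ∀ a {e v} {q : Is-just (attr a v)} → edge e ≡ loop a v q → ⊥
  edge≢loop label ()
  edge≢loop root  ()

  -- Merges the two loop constructors into one case indexed by the attribute, so that case analyses
  -- treat labels and rootedness together.
  data EdgeView : e-Edge G → Set where
    is-edge : ∀ e → EdgeView (edge e)
    is-loop : ∀ a v q → EdgeView (loop a v q)

  view : ∀ x → EdgeView x
  view (edge e)        = is-edge e
  view (labelLoop v q) = is-loop label v q
  view (rootLoop  v q) = is-loop root v q

  attr-total : R-GT.IsTLRG G → ∀ a v → Is-just (attr a v)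
  attr-total G-tlrg label = R-GT.IsTLRG.l-total G-tlrg
  attr-total G-tlrg root  = R-GT.IsTLRG.p-total G-tlrg

-- Morphisms between encodings

module _ {𝓛 : Alphabet} (A B : R-GT.Graph 𝓛)
         (φ : SkeletonMor (encode {𝓛} A) (encode {𝓛} B)) where

  -- Edge labels are preserved, and the labels of proper edges and of loops lie in different
  -- summands of the encoded alphabet.
  edge-image : ∀ e → ∃[ e′ ] (fE φ (edge e) ≡ edge e′)
  edge-image e with fE φ (edge e) | m-pres φ (edge e)
  ... | edge e′       | _ = e′ , refl
  ... | labelLoop _ _ | ()
  ... | rootLoop _ _  | ()

  -- The summand of the label fixes the kind of the image, preservation of sources fixes its node,
  -- and the label itself gives the equality of witnesses.
  loop-image : ∀ a v q → ∃[ q′ ] (fE φ (loop A a v q) ≡ loop B a (fV φ v) q′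
                                  × to-witness q′ ≡ to-witness q)
  loop-image label v q
    with fE φ (labelLoop v q) | s-pres φ (labelLoop v q) | m-pres φ (labelLoop v q)
  ... | labelLoop _ q′ | refl | eq = q′ , refl , inj₁-injective (inj₂-injective eq)
  loop-image root v q
    with fE φ (rootLoop v q) | s-pres φ (rootLoop v q) | m-pres φ (rootLoop v q)
  ... | rootLoop _ q′ | refl | eq = q′ , refl , inj₂-injective (inj₂-injective eq)

  -- Since `φ` preserves the kind of every edge, it also reflects it; comparing two descriptions of
  -- the image yields the attribute and the node.
  loop-preimage : ∀ a {x w q} → fE φ x ≡ loop B a w q →
                  ∃[ v ] ∃[ q′ ] (x ≡ loop A a v q′ × fV φ v ≡ w)
  loop-preimage a {x} eq with view A x
  ... | is-edge e     = ⊥-elim (edge≢loop B a (trans (sym (proj₂ (edge-image e))) eq))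
  ... | is-loop b v q with loop-injective B b a (trans (sym (proj₁ (proj₂ (loop-image b v q)))) eq)
  ...   | refl , v≡w = v , q , refl , v≡w

  edge-preimage : ∀ {x e} → fE φ x ≡ edge e → ∃[ e′ ] (x ≡ edge e′)
  edge-preimage {x} eq with view A x
  ... | is-edge e     = e , refl
  ... | is-loop b v q =
    ⊥-elim (edge≢loop B b (trans (sym eq) (proj₁ (proj₂ (loop-image b v q)))))

  -- A defined value is the label of a loop, and the image loop at `fV φ v` carries the same label.
  attr-pres : ∀ a v x → attr A a v ≡ just x → attr B a (fV φ v) ≡ just x
  attr-pres a v x eq =
    let q′ , _ , w≡ = loop-image a v (defined eq)
    in  witness⇒just q′ (trans w≡ (defined-witness eq))

  decode : R-GT.Mor A B
  decode = record { skel = ψ ; l-pres = attr-pres label ; p-pres = attr-pres root }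
    where
    ψ : SkeletonMor (R-GT.skeleton A) (R-GT.skeleton B)
    ψ .fV = fV φ
    ψ .fE e = proj₁ (edge-image e)
    ψ .s-pres e with fE φ (edge e) | m-pres φ (edge e) | s-pres φ (edge e)
    ... | edge _        | _  | eq = eq
    ... | labelLoop _ _ | () | _
    ... | rootLoop _ _  | () | _
    ψ .t-pres e with fE φ (edge e) | m-pres φ (edge e) | t-pres φ (edge e)
    ... | edge _        | _  | eq = eq
    ... | labelLoop _ _ | () | _
    ... | rootLoop _ _  | () | _
    ψ .m-pres e with fE φ (edge e) | m-pres φ (edge e)
    ... | edge _        | eq = inj₁-injective eq
    ... | labelLoop _ _ | ()
    ... | rootLoop _ _  | ()

  decode-injective : IsInjective φ → IsInjective (R-GT.skel decode)
  decode-injective (injV , injE) = injV , λ {e} {e′} eq → inj₁-injective (injE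
    (trans (proj₂ (edge-image e)) (trans (cong edge eq) (sym (proj₂ (edge-image e′))))))

e-skel : (A B : R-GT.Graph 𝓛) → R-GT.Mor A B → SkeletonMor (encode {𝓛} A) (encode {𝓛} B)
e-skel {𝓛} A B f = T-GT.skel {G = e-graph {𝓛} A} {e-graph {𝓛} B} (e-mor {G = A} {B} f)

e-skel-inverse : (A B : R-GT.Graph 𝓛) (f : R-GT.Mor A B) (g : R-GT.Mor B A) →
                 let f₀ = R-GT.skel f ; g₀ = R-GT.skel g in
                 (∀ v → fV g₀ (fV f₀ v) ≡ v) → (∀ e → fE g₀ (fE f₀ e) ≡ e) →
                 ∀ x → fE (e-skel B A g) (fE (e-skel A B f) x) ≡ x
e-skel-inverse A B f g gfV gfE (edge e)        = cong edge (gfE e)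
e-skel-inverse A B f g gfV gfE (labelLoop v q) = loop-cong A label (gfV v)
e-skel-inverse A B f g gfV gfE (rootLoop v q)  = loop-cong A root (gfV v)

encode-≅ : (A B : R-GT.Graph 𝓛) → A R-GT.≅ B → encode {𝓛} A ≅ₛ encode {𝓛} B
encode-≅ A B (f , g , (gfV , gfE) , (fgV , fgE)) =
  mk≅ (e-skel A B f) (e-skel B A g)
      ((gfV , e-skel-inverse A B f g gfV gfE) , (fgV , e-skel-inverse B A g f fgV fgE))

decode-inverse : (A B : R-GT.Graph 𝓛)
                 (φ : SkeletonMor (encode {𝓛} A) (encode {𝓛} B))
                 (ψ : SkeletonMor (encode {𝓛} B) (encode {𝓛} A)) →
                 (∀ x → fE ψ (fE φ x) ≡ x) →
                 ∀ e → fE (R-GT.skel (decode B A ψ)) (fE (R-GT.skel (decode A B φ)) e) ≡ e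
decode-inverse A B φ ψ ψφ e = inj₁-injective
  (trans (sym (proj₂ (edge-image B A ψ _)))
         (trans (cong (fE ψ) (sym (proj₂ (edge-image A B φ e)))) (ψφ (edge e))))

decode-≅ : (A B : R-GT.Graph 𝓛) → encode {𝓛} A ≅ₛ encode {𝓛} B → A R-GT.≅ B
decode-≅ A B (mk≅ φ ψ ((ψφV , ψφE) , (φψV , φψE))) =
  decode A B φ , decode B A ψ ,
  (ψφV , decode-inverse A B φ ψ ψφE) , (φψV , decode-inverse B A ψ φ φψE)

module _ {𝓛 : Alphabet} (A B : R-GT.Graph 𝓛) (f : R-GT.Mor A B) where

  edge∈im⇒∈im : ∀ {e} → edge e ∈im fE (e-skel A B f) → e ∈im fE (R-GT.skel f)
  edge∈im⇒∈im (x , eq) with edge-preimage A B (e-skel A B f) {x} eq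
  ... | e′ , refl = e′ , inj₁-injective eq

  ∈im⇒edge∈im : ∀ {e} → e ∈im fE (R-GT.skel f) → edge e ∈im fE (e-skel A B f)
  ∈im⇒edge∈im (e′ , eq) = edge e′ , cong edge eq

-- Attributes of the result of a rule application

module Gluing {K D R : Skeleton Lab} (d : SkeletonMor K D) (j : SkeletonMor K R)
              (d-inj : Injective _≡_ _≡_ (fV d)) (j-inj : Injective _≡_ _≡_ (fV j)) where

  open Addition d j

  glue-old : ∀ k → glue (fV j k) ≡ inj₁ (fV d k)
  glue-old k with ∈im? (V-finite K) (V-finite R) (fV j) (fV j k)
  ... | yes (_ , eq) = cong (inj₁ ∘ fV d) (j-inj eq)
  ... | no ∉j        = contradiction (k , refl) ∉j

  glue-new : ∀ u .(∉j : ¬ (u ∈im fV j)) → glue u ≡ inj₂ (u , [ ∉j ])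
  glue-new u ∉j with ∈im? (V-finite K) (V-finite R) (fV j) u
  ... | yes ∈j = ⊥-elim-irr (∉j ∈j)
  ... | no _   = refl

  glue≡inj₁ : ∀ u {v} → glue u ≡ inj₁ v → ∃[ k ] (fV j k ≡ u × fV d k ≡ v)
  glue≡inj₁ u eq with ∈im? (V-finite K) (V-finite R) (fV j) u
  glue≡inj₁ u refl | yes (k , jk≡u) = k , jk≡u , refl

  glue≡inj₂ : ∀ u {w} → glue u ≡ inj₂ w → u ≡ value w
  glue≡inj₂ u eq with ∈im? (V-finite K) (V-finite R) (fV j) u
  glue≡inj₂ u refl | no _ = refl

  -- Nodes of `R` glued to the same node of `D` come from nodes of `K` on which `d` agrees, so
  -- injectivity of `d` identifies them.
  glue-injective : ∀ {u u′} → glue u ≡ glue u′ → u ≡ u′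
  glue-injective {u} {u′} eq with glue u′ in eq′
  ... | inj₂ _ = trans (glue≡inj₂ u eq) (sym (glue≡inj₂ u′ eq′))
  ... | inj₁ _ with glue≡inj₁ u eq | glue≡inj₁ u′ eq′
  ...   | k , refl , dk≡ | k′ , refl , dk′≡ = cong (fV j) (d-inj (trans dk≡ (sym dk′≡)))

  module _ {X : Set} (α : V K → Maybe X) where

    -- Kept v: the attribute of v survives the deletion.
    -- New u: the attribute of u is introduced by the right-hand side.
    Kept : V D → Set
    Kept v = ∀ k → fV d k ≡ v → Is-just (α k)

    New : V R → Set
    New u = ∀ k → fV j k ≡ u → ¬ Is-just (α k)

    -- Outside `K` the origin of the node decides. At `d(k)`, which is also the glued image of
    -- `j(k)`, definedness of `α k` decides; injectivity of `d` and `j` makes `k` the only preimage.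
    kept-or-new : ∀ w → (∃[ v ] (Kept v × inj₁ v ≡ w)) ⊎ (∃[ u ] (New u × glue u ≡ w))
    kept-or-new (inj₂ (u , [ ∉j ])) =
      inj₂ (u , (λ k eq _ → ⊥-elim-irr (∉j (k , eq))) , glue-new u ∉j)
    kept-or-new (inj₁ v) with ∈im? (V-finite K) (V-finite D) (fV d) v
    ... | no ∉d = inj₁ (v , (λ k eq → contradiction (k , eq) ∉d) , refl)
    ... | yes (k , refl) with Any.dec (λ _ → yes tt) (α k)
    ...   | yes αk = inj₁ (fV d k , (λ k′ eq → subst (Is-just ∘ α) (sym (d-inj eq)) αk) , refl)
    ...   | no ¬αk = inj₂ (fV j k , (λ k′ eq → subst (¬_ ∘ Is-just ∘ α) (sym (j-inj eq)) ¬αk)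
                          , glue-old k)

    -- A node lying on both sides comes from some `k`, where `α` would be both defined and
    -- undefined.
    kept⇒¬new : ∀ {v u} → glue u ≡ inj₁ v → Kept v → ¬ New u
    kept⇒¬new {u = u} eq kept new =
      let k , jk≡u , dk≡v = glue≡inj₁ u eq in new k jk≡u (kept k dk≡v)

    override-kept : (new : V K → Maybe X) (old : V D → Maybe X) →
                    ∀ v → Kept v → R-GT.override d α new old v ≡ old v
    override-kept new old v kept with ∈im? (V-finite K) (V-finite D) (fV d) v
    ... | no _ = refl
    ... | yes (k , eq) with α k | kept k eq
    ...   | just _ | _ = refl

    override-undefined : (new : V K → Maybe X) (old : V D → Maybe X) →
                         ∀ k → ¬ Is-just (α k) → R-GT.override d α new old (fV d k) ≡ new k
    override-undefined new old k ¬αk with ∈im? (V-finite K) (V-finite D) (fV d) (fV d k)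
    ... | no ∉d = contradiction (k , refl) ∉d
    -- The search for a preimage may return another node of `K`; injectivity of `d` identifies it
    -- with `k`.
    ... | yes (k′ , eq) with d-inj eq
    ...   | refl with α k
    ...     | just _  = contradiction (Any.just tt) ¬αk
    ...     | nothing = refl

    -- `ρ` stands for the label or rootedness function of the result, and `α`, `β`, `γ` for those of
    -- `K`, `R` and of `G` restricted to `D`. The two equations unfold the definition of the result,
    -- once for both attributes.
    module _ (β : V R → Maybe X) (γ : V D → Maybe X) (ρ : V H → Maybe X)
             (ρ-inj₁ : ∀ v → ρ (inj₁ v) ≡ R-GT.override d α (β ∘ fV j)
                                            (R-GT.override d α (const nothing) γ) v)
             (ρ-inj₂ : ∀ w → ρ (inj₂ w) ≡ β (value w)) where

      attribute-kept : ∀ v → Kept v → ρ (inj₁ v) ≡ γ v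
      attribute-kept v kept =
        trans (ρ-inj₁ v)
              (trans (override-kept _ _ v kept) (override-kept (const nothing) γ v kept))

      attribute-new : ∀ u → New u → ρ (glue u) ≡ β u
      attribute-new u new with ∈im? (V-finite K) (V-finite R) (fV j) u
      ... | no _           = ρ-inj₂ _
      ... | yes (k , refl) = trans (ρ-inj₁ _) (override-undefined _ _ k (new k refl))

      attribute-total : (∀ v → Is-just (γ v)) → (∀ u → Is-just (β u)) → ∀ w → Is-just (ρ w)
      attribute-total γ-total β-total w with kept-or-new w
      ... | inj₁ (v , kept , refl) = subst Is-just (sym (attribute-kept v kept)) (γ-total v)
      ... | inj₂ (u , new , refl)  = subst Is-just (sym (attribute-new u new)) (β-total u)

-- Encoding commutes with rule application

-- The morphism h : e(L) → e(G) is given by an edge map over the node map of g,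
-- so that both derivations have definitionally equal sets of nodes.

module Comparison {𝓛 : Alphabet} (r : R-GT.Rule 𝓛) (G : R-GT.Graph 𝓛) (G-tlrg : R-GT.IsTLRG G)
                  (g : R-GT.Mor (R-GT.Rule.L r) G)
                  (hE : e-Edge (R-GT.Rule.L r) → e-Edge G)
                  (hE-edge : ∀ e → hE (edge e) ≡ edge (fE (R-GT.skel g) e))
                  (hE-s : ∀ x → s (encode {𝓛} G) (hE x) ≡
                                fV (R-GT.skel g) (s (encode {𝓛} (R-GT.Rule.L r)) x))
                  (hE-t : ∀ x → t (encode {𝓛} G) (hE x) ≡
                                fV (R-GT.skel g) (t (encode {𝓛} (R-GT.Rule.L r)) x))
                  (hE-m : ∀ x → m (encode {𝓛} G) (hE x) ≡ m (encode {𝓛} (R-GT.Rule.L r)) x)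
                  (h-l : V (R-GT.skeleton (R-GT.Rule.L r)) → tt ≡ tt) where

  open R-GT.Rule r
  open R-GT using (skel; skeleton)

  h₀ : SkeletonMor (encode {𝓛} L) (encode {𝓛} G)
  h₀ = record { fV = fV (skel g) ; fE = hE ; s-pres = hE-s ; t-pres = hE-t ; m-pres = hE-m }

  h : T-GT.Mor (e-graph {𝓛} L) (e-graph {𝓛} G)
  h = record { skel = h₀ ; l-pres = h-l }

  ei : SkeletonMor (encode {𝓛} K) (encode {𝓛} L)
  ei = e-skel K L i

  ej : SkeletonMor (encode {𝓛} K) (encode {𝓛} R)
  ej = e-skel K R j

  loop-undeleted : ∀ a {v q} → ¬ (loop G a v q ∈im fE h₀) → ¬ DeletedV (skel i) (skel g) v
  loop-undeleted a ∉h (u , _ , hu≡v) = ∉h (loop L a u (attr-total L L-tlrg a u) ,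
    trans (proj₁ (proj₂ (loop-image L G h₀ a u _))) (loop-cong G a hu≡v))

  -- Loops at deleted nodes of G are images of loops of L, since both graphs
  -- are total; so the dangling conditions agree.
  dangling-encode : Dangling (skel i) (skel g) → Dangling ei h₀
  dangling-encode dangling (edge e) ∉h =
    dangling e λ { (e′ , refl) → ∉h (edge e′ , hE-edge e′) }
  dangling-encode dangling (labelLoop v q) ∉h = loop-undeleted label ∉h , loop-undeleted label ∉h
  dangling-encode dangling (rootLoop v q)  ∉h = loop-undeleted root ∉h , loop-undeleted root ∉h

  fE-g : ∀ {e e′} → hE (edge e) ≡ edge e′ → fE (skel g) e ≡ e′
  fE-g eq = inj₁-injective (trans (sym (hE-edge _)) eq)

  edge∈im-h : ∀ {e} → edge e ∈im hE → e ∈im fE (skel g)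
  edge∈im-h (x , eq) with edge-preimage L G h₀ {x} eq
  ... | e′ , refl = e′ , fE-g eq

  dangling-decode : Dangling ei h₀ → Dangling (skel i) (skel g)
  dangling-decode dangling e ∉g = dangling (edge e) (∉g ∘ edge∈im-h)

  deleted-edge⇒ : ∀ {e} → DeletedE ei h₀ (edge e) → DeletedE (skel i) (skel g) e
  deleted-edge⇒ (x , x∉ , eq) with edge-preimage L G h₀ {x} eq
  ... | e′ , refl = e′ , x∉ ∘ ∈im⇒edge∈im K L i , fE-g eq

  deleted-edge⇐ : ∀ {e} → DeletedE (skel i) (skel g) e → DeletedE ei h₀ (edge e)
  deleted-edge⇐ (e′ , e′∉ , refl) = edge e′ , e′∉ ∘ edge∈im⇒∈im K L i , hE-edge e′

  -- The two results: attributes, surviving loops and added loops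

  module _ (h-inj : IsInjective h₀) (dangling : Dangling ei h₀)
           (g-inj : IsInjective (skel g)) (dangling′ : Dangling (skel i) (skel g)) where

    module RD = R-GT.Derivation r g g-inj dangling′
    module TD = T-GT.Derivation (e-rule {𝓛} r) h h-inj dangling
    open Gluing RD.Del.d (skel j) (λ eq → proj₁ i-inj (proj₁ g-inj (cong value eq))) (proj₁ j-inj)

    T-result : Skeleton (LE (e-alphabet 𝓛))
    T-result = T-GT.skeleton TD.result

    R-result : Skeleton (LE (e-alphabet 𝓛))
    R-result = encode {𝓛} RD.result

    value-kept : ∀ a v → Kept (attr K a) v → attr RD.result a (inj₁ v) ≡ attr G a (value v)
    value-kept label = attribute-kept _ (attr R label) _ (attr RD.result label)
                         (λ _ → refl) (λ _ → refl)
    value-kept root  = attribute-kept _ (attr R root) _ (attr RD.result root)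
                         (λ _ → refl) (λ _ → refl)

    value-new : ∀ a u → New (attr K a) u → attr RD.result a (RD.Add.glue u) ≡ attr R a u
    value-new label = attribute-new _ (attr R label) (attr G label ∘ value)
                        (attr RD.result label) (λ _ → refl) (λ _ → refl)
    value-new root  = attribute-new _ (attr R root) (attr G root ∘ value)
                        (attr RD.result root) (λ _ → refl) (λ _ → refl)

    total : ∀ a w → Is-just (attr RD.result a w)
    total label = attribute-total _ (attr R label) (attr G label ∘ value) (attr RD.result label)
                    (λ _ → refl) (λ _ → refl) (attr-total G G-tlrg label ∘ value)
                    (attr-total R R-tlrg label)
    total root  = attribute-total _ (attr R root) (attr G root ∘ value) (attr RD.result root)
                    (λ _ → refl) (λ _ → refl) (attr-total G G-tlrg root ∘ value)
                    (attr-total R R-tlrg root)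

    -- Both functions search for the same preimage but are stuck on it as instances at different
    -- skeletons; once the search is resolved they agree definitionally.
    glue-≡ : ∀ u → TD.Add.glue u ≡ RD.Add.glue u
    glue-≡ u with ∈im? (V-finite (skeleton K)) (V-finite (skeleton R)) (fV (skel j)) u
    ... | yes _ = refl
    ... | no _  = refl

    -- If `K` left the attribute of `k` undefined, the loop that the total graph `L` has at `i(k)`
    -- would lie outside `e(K)`, and its image, the loop at `v`, would be deleted.
    loop-kept⇒ : ∀ a v {q} → .(¬ DeletedE ei h₀ (loop G a (value v) q)) → Kept (attr K a) v
    loop-kept⇒ a v ¬del k eq with Any.dec (λ _ → yes tt) (attr K a k)
    ... | yes αk = αk
    ... | no ¬αk = ⊥-elim-irr (¬del
      ( loop L a (fV (skel i) k) (attr-total L L-tlrg a _)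
      , (λ (x , eq′) → let k′ , q , _ , ik′≡ = loop-preimage K L ei a {x} eq′
                       in ¬αk (subst (Is-just ∘ attr K a) (proj₁ i-inj ik′≡) q))
      , trans (proj₁ (proj₂ (loop-image L G h₀ a _ _))) (loop-cong G a (cong value eq)) ))

    -- A deleted loop is the image of a loop of `L` at some `u`. If `u` is outside `K`, then `v`
    -- itself is deleted; otherwise `kept` provides the loop of `e(K)` that maps to it.
    loop-kept⇐ : ∀ a v {q} → Kept (attr K a) v → ¬ DeletedE ei h₀ (loop G a (value v) q)
    loop-kept⇐ a (_ , [ ¬del ]) kept (x , x∉ , eq) with loop-preimage L G h₀ a {x} eq
    ... | u , q , refl , hu≡v
      with ∈im? (V-finite (skeleton K)) (V-finite (skeleton L)) (fV (skel i)) u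
    ...   | no ∉i = ⊥-elim-irr (¬del (u , ∉i , hu≡v))
    ...   | yes (k , refl) = x∉ (loop K a k (kept k (refine-≡ hu≡v)) ,
              trans (proj₁ (proj₂ (loop-image K L ei a k _))) (loop-cong L a refl))

    loop-new⇒ : ∀ a u {q} → .(¬ (loop R a u q ∈im fE ej)) → New (attr K a) u
    loop-new⇒ a u ∉j k jk≡u q = ⊥-elim-irr (∉j (loop K a k q ,
      trans (proj₁ (proj₂ (loop-image K R ej a k q))) (loop-cong R a jk≡u)))

    loop-new⇐ : ∀ a u {q} → New (attr K a) u → ¬ (loop R a u q ∈im fE ej)
    loop-new⇐ a u new (x , eq) =
      let k , q , _ , jk≡u = loop-preimage K R ej a {x} eq in new k jk≡u q

    -- The bijection between the edges of the two results

    loop-at : ∀ a → V R-result → E R-result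
    loop-at a w = loop RD.result a w (total a w)

    to : E T-result → E R-result
    to (inj₁ (edge e , [ ¬del ])) = edge (inj₁ (e , [ ¬del ∘ deleted-edge⇐ ]))
    to (inj₂ (edge x , [ ∉j ]))   = edge (inj₂ (x , [ ∉j ∘ ∈im⇒edge∈im K R j ]))
    to x@(inj₁ (labelLoop _ _ , _)) = loop-at label (s T-result x)
    to x@(inj₁ (rootLoop _ _ , _)) = loop-at root (s T-result x)
    -- The node is written with the gluing of the rooted derivation, the form in which `value-new`
    -- and `kept-or-new` speak of it.
    to (inj₂ (labelLoop u _ , _)) = loop-at label (RD.Add.glue u)
    to (inj₂ (rootLoop u _ , _)) = loop-at root (RD.Add.glue u)

    kept-loop : ∀ a v → Kept (attr K a) v → E T-result
    kept-loop a v kept =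
      inj₁ (loop G a (value v) (attr-total G G-tlrg a _) , [ loop-kept⇐ a v kept ])

    new-loop : ∀ a u → New (attr K a) u → E T-result
    new-loop a u new = inj₂ (loop R a u (attr-total R R-tlrg a u) , [ loop-new⇐ a u new ])

    -- Evidence of definedness in the result does not tell where a loop comes from; its origin in
    -- `G` or `R` is recovered by `kept-or-new`.
    from-loop : ∀ a → V T-result → E T-result
    from-loop a w with kept-or-new (attr K a) w
    ... | inj₁ (v , kept , _) = kept-loop a v kept
    ... | inj₂ (u , new , _)  = new-loop a u new

    from : E R-result → E T-result
    from (edge (inj₁ (e , [ ¬del ]))) = inj₁ (edge e , [ ¬del ∘ deleted-edge⇒ ])
    from (edge (inj₂ (x , [ ∉j ])))   = inj₂ (edge x , [ ∉j ∘ edge∈im⇒∈im K R j ])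
    from (labelLoop w _) = from-loop label w
    from (rootLoop w _)  = from-loop root w

    to-kept-loop : ∀ a v kept → to (kept-loop a v kept) ≡ loop-at a (inj₁ v)
    to-kept-loop label v kept = refl
    to-kept-loop root  v kept = refl

    to-new-loop : ∀ a u new → to (new-loop a u new) ≡ loop-at a (RD.Add.glue u)
    to-new-loop label u new = refl
    to-new-loop root  u new = refl

    to-from-loop : ∀ a w q → to (from-loop a w) ≡ loop RD.result a w q
    to-from-loop a w q with kept-or-new (attr K a) w
    ... | inj₁ (v , kept , refl) = trans (to-kept-loop a v kept) (loop-cong RD.result a refl)
    ... | inj₂ (u , new , refl)  = trans (to-new-loop a u new) (loop-cong RD.result a refl)

    to-from : ∀ y → to (from y) ≡ y
    to-from (edge (inj₁ _))  = refl
    to-from (edge (inj₂ _))  = refl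
    to-from (labelLoop w q) = to-from-loop label w q
    to-from (rootLoop w q)  = to-from-loop root w q

    -- Survival of the loop makes `v` kept, which rules out the answer that the loop is new.
    from-kept-loop : ∀ a v {q} .(¬del : ¬ DeletedE ei h₀ (loop G a (value v) q)) →
                     from-loop a (inj₁ v) ≡ inj₁ (loop G a (value v) q , [ ¬del ])
    from-kept-loop a v ¬del with kept-or-new (attr K a) (inj₁ v)
    ... | inj₁ (_ , _ , refl)  = cong inj₁ (refine-≡ (loop-cong G a refl))
    ... | inj₂ (u , new , eq) =
      ⊥-elim (kept⇒¬new (attr K a) eq (loop-kept⇒ a v ¬del) new)

    from-new-loop : ∀ a u {q} .(∉j : ¬ (loop R a u q ∈im fE ej)) →
                    from-loop a (RD.Add.glue u) ≡ inj₂ (loop R a u q , [ ∉j ])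
    from-new-loop a u ∉j with kept-or-new (attr K a) (RD.Add.glue u)
    ... | inj₁ (v , kept , eq) =
      ⊥-elim (kept⇒¬new (attr K a) (sym eq) kept (loop-new⇒ a u ∉j))
    -- The node `u′` found here is only known to have the same glued image as `u`.
    ... | inj₂ (u′ , _ , eq) = cong inj₂ (refine-≡ (loop-cong R a (glue-injective eq)))

    from-to : ∀ x → from (to x) ≡ x
    from-to (inj₁ (edge _ , _)) = refl
    from-to (inj₂ (edge _ , _)) = refl
    from-to (inj₁ x@(labelLoop _ _ , [ ¬del ])) = from-kept-loop label (s TD.Del.D x) ¬del
    from-to (inj₁ x@(rootLoop _ _ , [ ¬del ])) = from-kept-loop root (s TD.Del.D x) ¬del
    from-to (inj₂ (labelLoop u _ , [ ∉j ]))   = from-new-loop label u ∉j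
    from-to (inj₂ (rootLoop u _ , [ ∉j ]))    = from-new-loop root u ∉j

    -- This is label preservation on surviving loops: where the attribute is kept, the result has
    -- the value of `G`.
    kept-witness : ∀ a v q → .(¬ DeletedE ei h₀ (loop G a (value v) q)) →
                   to-witness (total a (inj₁ v)) ≡ to-witness q
    kept-witness a v q ¬del =
      witness-cong (value-kept a v (loop-kept⇒ a v ¬del)) (total a (inj₁ v)) q

    new-witness : ∀ a u q → .(¬ (loop R a u q ∈im fE ej)) →
                  to-witness (total a (RD.Add.glue u)) ≡ to-witness q
    new-witness a u q ∉j =
      witness-cong (value-new a u (loop-new⇒ a u ∉j)) (total a (RD.Add.glue u)) q

    to-mor : SkeletonMor T-result R-result
    to-mor .fV = id
    to-mor .fE = to
    to-mor .s-pres (inj₁ (edge _ , _)) = refl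
    to-mor .s-pres (inj₂ (edge x , _)) = sym (glue-≡ (s (skeleton R) x))
    to-mor .s-pres (inj₁ (labelLoop _ _ , _)) = refl
    to-mor .s-pres (inj₁ (rootLoop _ _ , _))  = refl
    to-mor .s-pres (inj₂ (labelLoop u _ , _)) = sym (glue-≡ u)
    to-mor .s-pres (inj₂ (rootLoop u _ , _)) = sym (glue-≡ u)
    to-mor .t-pres (inj₁ (edge _ , _)) = refl
    to-mor .t-pres (inj₂ (edge x , _)) = sym (glue-≡ (t (skeleton R) x))
    to-mor .t-pres (inj₁ (labelLoop _ _ , _)) = refl
    to-mor .t-pres (inj₁ (rootLoop _ _ , _))  = refl
    to-mor .t-pres (inj₂ (labelLoop u _ , _)) = sym (glue-≡ u)
    to-mor .t-pres (inj₂ (rootLoop u _ , _)) = sym (glue-≡ u)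
    to-mor .m-pres (inj₁ (edge _ , _)) = refl
    to-mor .m-pres (inj₂ (edge _ , _)) = refl
    to-mor .m-pres (inj₁ x@(labelLoop _ q , [ ¬del ])) =
      cong (inj₂ ∘ inj₁) (kept-witness label (s TD.Del.D x) q ¬del)
    to-mor .m-pres (inj₁ x@(rootLoop _ q , [ ¬del ])) =
      cong (inj₂ ∘ inj₂) (kept-witness root (s TD.Del.D x) q ¬del)
    to-mor .m-pres (inj₂ (labelLoop u q , [ ∉j ])) = cong (inj₂ ∘ inj₁) (new-witness label u q ∉j)
    to-mor .m-pres (inj₂ (rootLoop u q , [ ∉j ])) = cong (inj₂ ∘ inj₂) (new-witness root u q ∉j)

    results-≅ : T-result ≅ₛ R-result
    results-≅ = bijective⇒≅ₛ to-mor id from (λ _ → refl) from-to (λ _ → refl) to-from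

  -- Generalised from h to h′ ≡ h: for a match that equals h only up to η, the
  -- result graphs would have to be compared by unfolding them completely.
  results-≅′ : ∀ h′ → h ≡ h′ → (h-inj : IsInjective (T-GT.skel h′))
               (dangling : Dangling ei (T-GT.skel h′))
               (g-inj : IsInjective (skel g)) (dangling′ : Dangling (skel i) (skel g)) →
               T-GT.skeleton (T-GT.Derivation.result (e-rule {𝓛} r) h′ h-inj dangling) ≅ₛ
               encode {𝓛} (R-GT.Derivation.result r g g-inj dangling′)
  results-≅′ _ refl = results-≅

-- Derivations up to isomorphism and the two directions of the equivalence

module _ {𝓛 : Alphabet} (H A : R-GT.Graph 𝓛) (B : T-GT.Graph (e-alphabet 𝓛))
         (B≅A : T-GT.skeleton B ≅ₛ encode {𝓛} A) where

  ≅⇒e-graph≅ : H R-GT.≅ A → e-graph {𝓛} H T-GT.≅ B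
  ≅⇒e-graph≅ H≅A =
    let mk≅ f g inverse = ≅ₛ-trans (encode-≅ H A H≅A) (≅ₛ-sym B≅A)
    in  record { skel = f ; l-pres = λ _ → refl } ,
        record { skel = g ; l-pres = λ _ → refl } , inverse

  e-graph≅⇒≅ : e-graph {𝓛} H T-GT.≅ B → H R-GT.≅ A
  e-graph≅⇒≅ (f , g , inverse) =
    decode-≅ H A (≅ₛ-trans (mk≅ (T-GT.skel f) (T-GT.skel g) inverse) B≅A)

module _ {𝓛 : Alphabet} (r : R-GT.Rule 𝓛) (G H : R-GT.Graph 𝓛) (G-tlrg : R-GT.IsTLRG G) where

  open R-GT.Rule r

  encode⇒ : G R-GT.⇒⟨ r ⟩ H → e-graph {𝓛} G T-GT.⇒⟨ e-rule {𝓛} r ⟩ e-graph {𝓛} H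
  encode⇒ (g , g-inj , dangling , H≅) =
    e-mor g , h-inj , dangling′ ,
    ≅⇒e-graph≅ H (R-GT.Derivation.result r {G} g g-inj dangling)
      (T-GT.Derivation.result (e-rule {𝓛} r) {e-graph {𝓛} G} (e-mor g) h-inj dangling′)
      (C.results-≅′ (e-mor g) refl h-inj dangling′ g-inj dangling) H≅
    where
    h₀ : SkeletonMor (encode {𝓛} L) (encode {𝓛} G)
    h₀ = e-skel L G g
    -- An encoded match acts on proper edges as `g` does by definition.
    module C = Comparison r G G-tlrg g (fE h₀) (λ _ → refl) (s-pres h₀) (t-pres h₀) (m-pres h₀)
                          (λ _ → refl)
    h-inj = e-mor-injective g g-inj
    dangling′ = C.dangling-encode dangling

  decode⇒ : e-graph {𝓛} G T-GT.⇒⟨ e-rule {𝓛} r ⟩ e-graph {𝓛} H → G R-GT.⇒⟨ r ⟩ H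
  decode⇒ (h , h-inj , dangling′ , H≅) =
    g , g-inj , dangling ,
    e-graph≅⇒≅ H (R-GT.Derivation.result r {G} g g-inj dangling)
      (T-GT.Derivation.result (e-rule {𝓛} r) {e-graph {𝓛} G} h h-inj dangling′)
      (C.results-≅′ h refl h-inj dangling′ g-inj dangling) H≅
    where
    h₀ : SkeletonMor (encode {𝓛} L) (encode {𝓛} G)
    h₀ = T-GT.skel h
    g : R-GT.Mor L G
    g = decode L G h₀
    -- Here `g` is read off from `h`, so agreement on proper edges comes from `edge-image`. All
    -- remaining components are those of `h`, so the rebuilt match equals `h` up to η.
    module C = Comparison r G G-tlrg g (fE h₀) (λ e → proj₂ (edge-image L G h₀ e))
                          (s-pres h₀) (t-pres h₀) (m-pres h₀) (T-GT.l-pres h)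
    g-inj : IsInjective (R-GT.skel g)
    g-inj = decode-injective L G h₀ h-inj
    dangling : Dangling (R-GT.skel i) (R-GT.skel g)
    dangling = C.dangling-decode dangling′

theorem6p1 : (𝓛 : Alphabet) (r : R-GT.Rule 𝓛) (G H : R-GT.Graph 𝓛) →
    R-GT.IsTLRG G → R-GT.IsTLRG H →
    (G R-GT.⇒⟨ r ⟩ H) ⇔ (e-graph G T-GT.⇒⟨ e-rule r ⟩ e-graph H)
theorem6p1 𝓛 r G H G-tlrg _ = mk⇔ (encode⇒ r G H G-tlrg) (decode⇒ r G H G-tlrg)
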